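{- Let $d\ge 1$ be an integer and let $Q_d$ be the $d$-dimensional hypercube graph. In the $(1:1)$ Maker-Breaker degree game played on $Q_d$, Breaker has a strategy to secure a degree of at least $\lfloor d/3\rfloor$ at every vertex; that is, $\delta_B(Q_d)\ge \lfloor d/3\rfloor$.
   Context: The hypercube graph $Q_d$ has vertex set $\{0,1\}^d$, two vertices being adjacent when they differ in exactly one coordinate. Degree game. Given a graph $G$, two players, Maker and Breaker, alternately claim previously unclaimed edges of $G$, one edge per turn, with Maker moving first, until all edges are claimed. For a nonnegative integer $t$, Breaker secures degree $t$ at every vertex if at the end of the game every vertex is incident to at least $t$ edges claimed by Breaker (equivalently, Maker never claims $\deg_G(x)-t+1$ edges at any vertex $x$). $\delta_B(G)$ denotes the largest $t$ for which Breaker has a strategy that, whatever Maker does, secures degree $t$ at every vertex. -}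

module Defs where

open import Data.Bool using (Bool; true; false)
import Data.Bool.Properties as Bool
open import Data.Fin using (Fin)
import Data.Fin.Properties as Fin
open import Data.List using (List; []; _∷_; [_]; _++_; length; filter; cartesianProductWith)
open import Data.List.Membership.Propositional using (_∈_)
open import Data.List.Membership.Propositional.Properties using (∈-cartesianProductWith⁺)
open import Data.List.Relation.Unary.Any using (Any; here; there)
open import Data.Nat using (ℕ; zero; suc; _≤_)
open import Data.Product using (∃; ∃!; _×_; _,_; proj₁)
open import Data.Sum using (_⊎_)
open import Data.Vec using (Vec; []; _∷_; lookup)
import Data.Vec.Properties as Vec
open import Relation.Binary using (Decidable; DecidableEquality; Symmetric)
open import Relation.Binary.PropositionalEquality using (_≡_; _≢_; refl; ≢-sym)
open import Relation.Nullary using (¬_; Dec)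
open import Relation.Nullary.Decidable using (map′; ¬?; _×-dec_; _⊎-dec_; _→-dec_)

record Graph : Set₁ where
  infix 4 _≟_ _~_ _~?_
  field
    V          : Set
    _≟_        : DecidableEquality V
    vertices   : List V
    ∈-vertices : ∀ v → v ∈ vertices
    _~_        : V → V → Set
    _~?_       : Decidable _~_
    ~-sym      : Symmetric _~_
    ~-irrefl   : ∀ {v} → ¬ (v ~ v)

data Player : Set where
  Maker Breaker : Player

module DegreeGame (G : Graph) where
  open Graph G

  -- An edge is unordered: the two orientations are identified by _≈_.
  record Edge : Set where
    constructor edge
    field
      src tgt : V
      adj     : src ~ tgt
  open Edge public

  infix 4 _≈_
  _≈_ : Edge → Edge → Set
  e ≈ f = (src e ≡ src f × tgt e ≡ tgt f) ⊎ (src e ≡ tgt f × tgt e ≡ src f)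

  Incident : V → Edge → Set
  Incident x e = x ≡ src e ⊎ x ≡ tgt e

  incident? : ∀ x e → Dec (Incident x e)
  incident? x e = (x ≟ src e) ⊎-dec (x ≟ tgt e)

  -- Claimed edges are listed most recent first, so a position records the
  -- whole history of the play.
  record Position : Set where
    constructor position
    field
      makerEdges breakerEdges : List Edge
  open Position public

  Unclaimed : Position → Edge → Set
  Unclaimed p e = ¬ Any (e ≈_) (makerEdges p ++ breakerEdges p)

  Finished : Position → Set
  Finished p = ¬ ∃ (Unclaimed p)

  claim : Player → Edge → Position → Position
  claim Maker   e (position ms bs) = position (e ∷ ms) bs
  claim Breaker e (position ms bs) = position ms (e ∷ bs)

  -- A reply is required only where some edge is still unclaimed; that
  -- hypothesis is irrelevant, so the reply depends on the position alone.
  Strategy : Set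
  Strategy = (p : Position) → .(∃ (Unclaimed p)) → ∃ (Unclaimed p)

  -- Reachable σ P p: p, with P to move, arises in a play in which Breaker
  -- follows σ and Maker makes arbitrary legal moves.
  data Reachable (σ : Strategy) : Player → Position → Set where
    start       : Reachable σ Maker (position [] [])
    makerMove   : ∀ {p} → Reachable σ Maker p →
                  ∀ e → Unclaimed p e → Reachable σ Breaker (claim Maker e p)
    breakerMove : ∀ {p} → Reachable σ Breaker p →
                  .(u : ∃ (Unclaimed p)) →
                  Reachable σ Maker (claim Breaker (proj₁ (σ p u)) p)

  -- No edge is ever claimed twice in a reachable position, so the list length
  -- counts distinct edges.
  breakerDegree : Position → V → ℕ
  breakerDegree p x = length (filter (incident? x) (breakerEdges p))

  Secures : Strategy → ℕ → Set
  Secures σ t = ∀ {P p} → Reachable σ P p → Finished p →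
                ∀ x → t ≤ breakerDegree p x

BreakerCanSecure : Graph → ℕ → Set
BreakerCanSecure G t = ∃ λ σ → Secures σ t
  where open DegreeGame G

IsδB : Graph → ℕ → Set
IsδB G k = BreakerCanSecure G k × (∀ t → BreakerCanSecure G t → t ≤ k)

DifferInOne : ∀ {d} → Vec Bool d → Vec Bool d → Set
DifferInOne u v = ∃! _≡_ λ i → lookup u i ≢ lookup v i

differInOne? : ∀ {d} → Decidable (DifferInOne {d})
differInOne? u v = Fin.any? λ i → differ? i ×-dec
    map′ (λ h {j} → h j) (λ h j → h {j}) (Fin.all? λ j → differ? j →-dec (i Fin.≟ j))
  where
  differ? : ∀ i → Dec (lookup u i ≢ lookup v i)
  differ? i = ¬? (lookup u i Bool.≟ lookup v i)

allBitVectors : ∀ d → List (Vec Bool d)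
allBitVectors zero    = [ [] ]
allBitVectors (suc d) = cartesianProductWith _∷_ (true ∷ false ∷ []) (allBitVectors d)

∈-allBitVectors : ∀ {d} (v : Vec Bool d) → v ∈ allBitVectors d
∈-allBitVectors []      = here refl
∈-allBitVectors (b ∷ v) = ∈-cartesianProductWith⁺ _∷_ (∈-bool b) (∈-allBitVectors v)
  where
  ∈-bool : ∀ b → b ∈ true ∷ false ∷ []
  ∈-bool true  = here refl
  ∈-bool false = there (here refl)

Q : ℕ → Graph
Q d = record
  { V          = Vec Bool d
  ; _≟_        = Vec.≡-dec Bool._≟_
  ; vertices   = allBitVectors d
  ; ∈-vertices = ∈-allBitVectors
  ; _~_        = DifferInOne
  ; _~?_       = differInOne?
  ; ~-sym      = λ { (i , i≢ , unique) → i , ≢-sym i≢ , λ j≢ → unique (≢-sym j≢) }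
  ; ~-irrefl   = λ { (_ , i≢ , _) → i≢ refl }
  }

{-# OPTIONS --safe #-}

-- Grouping the directions of Q_d in triples, with d mod 3 left over, puts every
-- vertex in ⌊d/3⌋ copies of Q_3, one per triple, and these boards are pairwise
-- edge-disjoint.  It therefore suffices that Breaker, moving second on Q_3, can
-- touch all eight vertices.  Evaluating a game tree of depth at most three shows
-- this; its leaves are positions won by pairing: each vertex is already touched,
-- or owns two unclaimed incident edges that no other vertex owns, and when Maker
-- takes one of the two Breaker takes the other.
-- On Q_d Breaker answers on the board where Maker has just moved.  An extra move
-- is never harmful, so Breaker plays anywhere when that board needs no answer.
module Submission where

open import Data.Bool using (Bool; true; false; not; _∧_; _∨_; T; T?)
open import Data.Bool.ListAction using (any; all)
open import Data.Bool.Properties using (T-∧; T-∨; T-≡)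
import Data.Bool.Properties as Bool
open import Data.Fin using (Fin; zero; suc; #_; toℕ; inject₁; _≟_; remQuot; splitAt; _↑ˡ_)
import Data.Fin.Properties as Fin
open import Data.Fin.Subset using (Subset; ⊥; inside; _∈_; _∉_; _⊆_)
open import Data.Fin.Subset.Properties using (_∈?_; anySubset?; ∉⊥)
open import Data.List using (List; []; _∷_; [_]; _++_; filter; length; allFin)
import Data.List as List
open import Data.List.Membership.Propositional using (lose; find) renaming (_∈_ to _∈ˡ_)
open import Data.List.Membership.Propositional.Properties using (∈-allFin; ∈-filter⁺)
open import Data.List.Membership.DecPropositional (_≟_ {12}) using () renaming (_∈?_ to _∈ˡ?_)
open import Data.List.Relation.Unary.All as All using (All)
open import Data.List.Relation.Unary.All.Properties using (all⁺)
open import Data.List.Relation.Unary.Any as Any using (Any; here; there; any?)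
open import Data.List.Relation.Unary.Any.Properties using (any⁺; any⁻; ++⁻; ++⁺ʳ; lookup-index)
open import Data.Nat using (ℕ; zero; suc; _≤_; _/_; z≤n; s≤s)
open import Data.Nat.DivMod using (m/n≡1+[m∸n]/n)
open import Data.Product using (∃; ∃₂; _×_; _,_; proj₁; proj₂)
open import Data.Sum as Sum using (_⊎_; inj₁; inj₂)
open import Data.Unit using (tt)
open import Data.Vec using (Vec; []; _∷_; lookup; _[_]≔_; insertAt) renaming (_++_ to _++ᵛ_)
open import Data.Vec.Properties
  using (lookup∘update′; ≡-dec; []≔-updates; []≔-minimal; []=⇒lookup; lookup⇒[]=; lookup-++ˡ; lookup-++ʳ)
open import Function using (_∘_; id; Equivalence)
open import Relation.Binary.PropositionalEquality using (_≡_; _≢_; refl; sym; trans; subst; cong)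
open import Relation.Nullary using (Dec; yes; no; contradiction)
open import Relation.Nullary.Decidable
  using (¬?; _×-dec_; _⊎-dec_; _→-dec_; map′; toWitness; decidable-stable; recompute)
open import Defs

-- The edges of the cube `Q_3`.

Vertex₃ : Set
Vertex₃ = Vec Bool 3

EdgeSet₃ : Set
EdgeSet₃ = Subset 12

-- An edge is numbered as four times its direction plus the index, in the table of `offset`, of its
-- two fixed coordinates.
axis : Fin 12 → Fin 3
axis = proj₁ ∘ remQuot {3} 4

offset : Fin 12 → Vec Bool 2
offset k = lookup ((false ∷ false ∷ []) ∷ (true ∷ false ∷ []) ∷ (false ∷ true ∷ []) ∷ (true ∷ true ∷ []) ∷ [])
                  (proj₂ (remQuot {3} 4 k))

low high : Fin 12 → Vertex₃
low  k = insertAt (offset k) (axis k) false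
high k = insertAt (offset k) (axis k) true

star : Vertex₃ → List (Fin 12)
star (false ∷ false ∷ false ∷ []) = # 0 ∷ # 4 ∷ # 8  ∷ []
star (true  ∷ false ∷ false ∷ []) = # 0 ∷ # 5 ∷ # 9  ∷ []
star (false ∷ true  ∷ false ∷ []) = # 1 ∷ # 4 ∷ # 10 ∷ []
star (true  ∷ true  ∷ false ∷ []) = # 1 ∷ # 5 ∷ # 11 ∷ []
star (false ∷ false ∷ true  ∷ []) = # 2 ∷ # 6 ∷ # 8  ∷ []
star (true  ∷ false ∷ true  ∷ []) = # 2 ∷ # 7 ∷ # 9  ∷ []
star (false ∷ true  ∷ true  ∷ []) = # 3 ∷ # 6 ∷ # 10 ∷ []
star (true  ∷ true  ∷ true  ∷ []) = # 3 ∷ # 7 ∷ # 11 ∷ []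

pairs : {A : Set} → List A → List (A × A)
pairs (a ∷ b ∷ c ∷ []) = (a , b) ∷ (a , c) ∷ (b , c) ∷ []
pairs _                = []

-- The four edges meeting k and one edge that is opposite to k in a face: they
-- suffice as candidates for Breaker's reply to k.
replies : Vec (List (Fin 12)) 12
replies = (# 8  ∷ # 9  ∷ # 1  ∷ # 5  ∷ # 4  ∷ [])
        ∷ (# 10 ∷ # 11 ∷ # 0  ∷ # 5  ∷ # 4  ∷ [])
        ∷ (# 8  ∷ # 9  ∷ # 3  ∷ # 7  ∷ # 6  ∷ [])
        ∷ (# 10 ∷ # 11 ∷ # 2  ∷ # 7  ∷ # 6  ∷ [])
        ∷ (# 0  ∷ # 1  ∷ # 6  ∷ # 10 ∷ # 8  ∷ [])
        ∷ (# 0  ∷ # 1  ∷ # 7  ∷ # 11 ∷ # 9  ∷ [])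
        ∷ (# 2  ∷ # 3  ∷ # 4  ∷ # 10 ∷ # 8  ∷ [])
        ∷ (# 2  ∷ # 3  ∷ # 5  ∷ # 11 ∷ # 9  ∷ [])
        ∷ (# 4  ∷ # 6  ∷ # 9  ∷ # 2  ∷ # 0  ∷ [])
        ∷ (# 5  ∷ # 7  ∷ # 8  ∷ # 2  ∷ # 0  ∷ [])
        ∷ (# 4  ∷ # 6  ∷ # 11 ∷ # 3  ∷ # 1  ∷ [])
        ∷ (# 5  ∷ # 7  ∷ # 10 ∷ # 3  ∷ # 1  ∷ [])
        ∷ []

-- Boolean search for safe positions.

infixr 5 _▸_
_▸_ : Fin 12 → EdgeSet₃ → EdgeSet₃
k ▸ A = A [ k ]≔ inside

-- Pairing: the vertices of vs untouched by R get pairwise disjoint pairs of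
-- incident edges outside U.
guarded : EdgeSet₃ → EdgeSet₃ → List Vertex₃ → Bool
guarded U R []       = true
guarded U R (v ∷ vs) =
  any (lookup R) (star v) ∧ guarded U R vs ∨
  any (λ (a , b) → not (lookup U a) ∧ not (lookup U b) ∧ guarded (a ▸ b ▸ U) R vs) (pairs (star v))

-- Opaque, since unfolding guarded over all eight vertices blows up.
opaque
  vertices₃ : List Vertex₃
  vertices₃ = allBitVectors 3

  ∈-vertices₃ : ∀ v → v ∈ˡ vertices₃
  ∈-vertices₃ = ∈-allBitVectors

-- Each vertex is tested alone, so pairs may overlap. This prunes the search and supplies
-- `safe-star` where no pairing exists yet.
alive : EdgeSet₃ → EdgeSet₃ → Bool
alive A R = all (λ v → guarded A R [ v ]) vertices₃

-- A bounds Maker's edges from above and R Breaker's from below, with Maker to move;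
-- n bounds the number of rounds until a pairing exists.
mutual
  safe : ℕ → EdgeSet₃ → EdgeSet₃ → Bool
  safe zero    A R = guarded A R vertices₃
  safe (suc n) A R = alive A R ∧ (safe zero A R ∨ all (answered n A R) (allFin 12))

  answered : ℕ → EdgeSet₃ → EdgeSet₃ → Fin 12 → Bool
  answered n A R k = lookup A k ∨ lookup R k ∨
    any (λ f → not (lookup (k ▸ A) f) ∧ not (lookup R f) ∧ safe n (k ▸ A) (f ▸ R)) (lookup replies k)

-- The finite range of depths keeps this decidable, as `safeBoard?` requires.
Safe : EdgeSet₃ → EdgeSet₃ → Set
Safe A R = ∃ λ (n : Fin 4) → T (safe (toℕ n) A R)

opaque
  unfolding vertices₃

  safe-start : Safe ⊥ ⊥
  -- `tt` suffices because the search of depth three evaluates to `true`.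
  safe-start = # 3 , tt

-- Membership and insertion in edge sets.

∈⇒T : ∀ {k} {A : EdgeSet₃} → k ∈ A → T (lookup A k)
∈⇒T = Equivalence.from T-≡ ∘ []=⇒lookup

T⇒∈ : ∀ {k} {A : EdgeSet₃} → T (lookup A k) → k ∈ A
T⇒∈ {k} {A} = lookup⇒[]= k A ∘ Equivalence.to T-≡

∉⇒T : ∀ {k} {A : EdgeSet₃} → k ∉ A → T (not (lookup A k))
∉⇒T {k} {A} k∉A with lookup A k in eq
... | true  = k∉A (lookup⇒[]= k A eq)
... | false = tt

T⇒∉ : ∀ {k} {A : EdgeSet₃} → T (not (lookup A k)) → k ∉ A
T⇒∉ t k∈A rewrite []=⇒lookup k∈A = t

∈-▸ : ∀ k A → k ∈ k ▸ A
∈-▸ k A = []≔-updates A k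

⊆-▸ : ∀ k A → A ⊆ k ▸ A
⊆-▸ k A {l} l∈A with l ≟ k
... | yes refl = ∈-▸ k A
... | no  l≢k  = []≔-minimal A l k l≢k l∈A

▸-∈⁻ : ∀ k A {l} → l ∈ k ▸ A → l ≡ k ⊎ l ∈ A
▸-∈⁻ k A {l} l∈ with l ≟ k
... | yes l≡k = inj₁ l≡k
... | no  l≢k = inj₂ (lookup⇒[]= l A (trans (sym (lookup∘update′ l≢k A inside)) ([]=⇒lookup l∈)))

▸-∉ : ∀ {k A l} → l ≢ k → l ∉ A → l ∉ k ▸ A
▸-∉ {k} {A} l≢k l∉A = Sum.[ l≢k , l∉A ] ∘ ▸-∈⁻ k A

▸-⊆ : ∀ {k A B} → k ∈ B → A ⊆ B → k ▸ A ⊆ B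
▸-⊆ {k} {A} k∈B A⊆B l∈ with ▸-∈⁻ k A l∈
... | inj₁ refl = k∈B
... | inj₂ l∈A  = A⊆B l∈A

▸-mono : ∀ k A B → A ⊆ B → k ▸ A ⊆ k ▸ B
▸-mono k A B A⊆B = ▸-⊆ (∈-▸ k B) (λ l∈A → ⊆-▸ k B (A⊆B l∈A))

⊆-▸▸ : ∀ a b U → U ⊆ a ▸ b ▸ U
⊆-▸▸ a b U = λ x∈U → ⊆-▸ a (b ▸ U) (⊆-▸ b U x∈U)

▸-swap : ∀ a b k U → a ▸ b ▸ k ▸ U ⊆ k ▸ a ▸ b ▸ U
▸-swap a b k U = ▸-⊆ (⊆-▸ k _ (∈-▸ a (b ▸ U)))
  (▸-⊆ (⊆-▸ k _ (⊆-▸ a _ (∈-▸ b U))) (▸-mono k U (a ▸ b ▸ U) (⊆-▸▸ a b U)))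

-- Play by pairing.

data Guarded (U R : EdgeSet₃) : List Vertex₃ → Set where
  []      : Guarded U R []
  touched : ∀ {v vs} → Any (_∈ R) (star v) → Guarded U R vs → Guarded U R (v ∷ vs)
  paired  : ∀ {v vs} a b → (a , b) ∈ˡ pairs (star v) → a ∉ U → b ∉ U →
            Guarded (a ▸ b ▸ U) R vs → Guarded U R (v ∷ vs)

guarded-sound : ∀ U R vs → T (guarded U R vs) → Guarded U R vs
guarded-sound U R []       _ = []
guarded-sound U R (v ∷ vs) t with Equivalence.to T-∨ t
... | inj₁ t′ = let hit , rest = Equivalence.to T-∧ t′ in
  touched (Any.map T⇒∈ (any⁻ (lookup R) (star v) hit)) (guarded-sound U R vs rest)
... | inj₂ t′ with find (any⁻ _ (pairs (star v)) t′)
... | (a , b) , ab∈ , t″ =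
  let a∉ , t‴   = Equivalence.to (T-∧ {not (lookup U a)}) t″
      b∉ , rest = Equivalence.to (T-∧ {not (lookup U b)}) t‴
  in paired a b ab∈ (T⇒∉ a∉) (T⇒∉ b∉) (guarded-sound (a ▸ b ▸ U) R vs rest)

guarded-complete : ∀ {U R vs} → Guarded U R vs → T (guarded U R vs)
guarded-complete [] = tt
guarded-complete (touched hit g) =
  Equivalence.from T-∨ (inj₁ (Equivalence.from T-∧ (any⁺ _ (Any.map ∈⇒T hit) , guarded-complete g)))
guarded-complete (paired a b ab∈ a∉ b∉ g) =
  Equivalence.from T-∨ (inj₂ (any⁺ _ (lose ab∈
    (Equivalence.from T-∧ (∉⇒T a∉ , Equivalence.from T-∧ (∉⇒T b∉ , guarded-complete g))))))

guarded-mono : ∀ {U U′ R R′ vs} → U′ ⊆ U → R ⊆ R′ → Guarded U R vs → Guarded U′ R′ vs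
guarded-mono U′⊆U R⊆R′ []              = []
guarded-mono U′⊆U R⊆R′ (touched hit g) = touched (Any.map R⊆R′ hit) (guarded-mono U′⊆U R⊆R′ g)
guarded-mono {U} {U′} U′⊆U R⊆R′ (paired a b ab∈ a∉ b∉ g) =
  paired a b ab∈ (λ a∈ → a∉ (U′⊆U a∈)) (λ b∈ → b∉ (U′⊆U b∈))
    (guarded-mono (▸-mono a _ _ (▸-mono b U′ U U′⊆U)) R⊆R′ g)

opaque
  unfolding vertices₃

  pairs-star : ∀ v → All (λ (a , b) → a ≢ b × a ∈ˡ star v × b ∈ˡ star v) (pairs (star v))
  pairs-star v = All.lookup checked (∈-vertices₃ v)
    where
    checked : All (λ v → All (λ (a , b) → a ≢ b × a ∈ˡ star v × b ∈ˡ star v) (pairs (star v))) vertices₃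
    checked = toWitness {a? = All.all? (λ v → All.all? (λ (a , b) →
      ¬? (a ≟ b) ×-dec (a ∈ˡ? star v) ×-dec (b ∈ˡ? star v)) (pairs (star v))) vertices₃} tt

-- The pairs are disjoint, so `k` meets at most one of them. If it meets none, no answer is due;
-- otherwise `f` is the partner of `k`.
guarded-reply : ∀ {U R vs k} → k ∉ U → Guarded U R vs →
  Guarded (k ▸ U) R vs ⊎ ∃ λ f → f ∉ k ▸ U × Guarded (k ▸ U) (f ▸ R) vs
guarded-reply k∉ [] = inj₁ []
guarded-reply {R = R} k∉ (touched hit g) with guarded-reply k∉ g
... | inj₁ g′            = inj₁ (touched hit g′)
... | inj₂ (f , f∉ , g′) = inj₂ (f , f∉ , touched (Any.map (⊆-▸ f R) hit) g′)
guarded-reply {U} {R} {_} {k} k∉ (paired {v} a b ab∈ a∉ b∉ g)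
  with All.lookup (pairs-star v) ab∈ | k ≟ a | k ≟ b
-- The partner `b` touches `v`. The remaining pairs already avoid `a`, hence survive Maker's move.
... | a≢b , a∈ , b∈ | yes refl | _ =
  inj₂ (b , ▸-∉ (a≢b ∘ sym) b∉ ,
        touched (lose b∈ (∈-▸ b R)) (guarded-mono (▸-mono a U (b ▸ U) (⊆-▸ b U)) (⊆-▸ b R) g))
... | a≢b , a∈ , b∈ | no _ | yes refl =
  inj₂ (a , ▸-∉ a≢b a∉ ,
        touched (lose a∈ (∈-▸ a R)) (guarded-mono (⊆-▸ a (b ▸ U)) (⊆-▸ a R) g))
-- The pair of `v` is intact; an answer found among the later pairs avoids `a` and `b` too.
... | _ | no k≢a | no k≢b = Sum.map keep
  (λ (f , f∉ , g′) → f , (λ f∈ → f∉ (▸-mono k U (a ▸ b ▸ U) (⊆-▸▸ a b U) f∈)) , keep g′)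
  (guarded-reply (▸-∉ k≢a (▸-∉ k≢b k∉)) g)
  where
  keep : ∀ {R′ vs} → Guarded (k ▸ a ▸ b ▸ U) R′ vs → Guarded (k ▸ U) R′ (v ∷ vs)
  keep g = paired a b ab∈ (▸-∉ (k≢a ∘ sym) a∉) (▸-∉ (k≢b ∘ sym) b∉)
    (guarded-mono (▸-swap a b k U) id g)

-- Meant for the end of play: with `U` bounding Maker's edges, an edge outside `U` must then be
-- Breaker's.
guarded-star : ∀ {U R v vs} → v ∈ˡ vs → Guarded U R vs → Any (λ k → k ∈ R ⊎ k ∉ U) (star v)
guarded-star (here refl) (touched hit _) = Any.map inj₁ hit
guarded-star (here refl) (paired {v} a b ab∈ a∉ _ _) =
  let _ , a∈ , _ = All.lookup (pairs-star v) ab∈ in lose a∈ (inj₂ a∉)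
guarded-star (there v∈) (touched _ g) = guarded-star v∈ g
guarded-star {U} (there v∈) (paired a b _ _ _ g) =
  Any.map (Sum.map₂ (λ k∉ k∈ → k∉ (⊆-▸▸ a b U k∈))) (guarded-star v∈ g)

-- Consequences of safety on `Q_3`.

safe-star : ∀ {A R} v → Safe A R → Any (λ k → k ∈ R ⊎ k ∉ A) (star v)
safe-star {A} {R} v (zero  , t) = guarded-star (∈-vertices₃ v) (guarded-sound A R vertices₃ t)
-- At positive depth `alive` handles `v` by itself.
safe-star {A} {R} v (suc n , t) = guarded-star (here refl) (guarded-sound A R [ v ] (All.lookup
  (all⁺ (λ v → guarded A R [ v ]) vertices₃ (proj₁ (Equivalence.to T-∧ t))) (∈-vertices₃ v)))

answered-reply : ∀ {A R k} (n : Fin 3) → k ∉ A → k ∉ R → T (answered (toℕ n) A R k) →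
  ∃ λ f → f ∉ k ▸ A × Safe (k ▸ A) (f ▸ R)
answered-reply {A} {R} {k} n k∉A k∉R t with Equivalence.to (T-∨ {lookup A k}) t
... | inj₁ k∈A = contradiction (T⇒∈ k∈A) k∉A
... | inj₂ t′ with Equivalence.to (T-∨ {lookup R k}) t′
... | inj₁ k∈R = contradiction (T⇒∈ k∈R) k∉R
... | inj₂ t″ with find (any⁻ _ (lookup replies k) t″)
... | f , _ , u =
  let f∉ , u′ = Equivalence.to (T-∧ {not (lookup (k ▸ A) f)}) u
      _  , u″ = Equivalence.to (T-∧ {not (lookup R f)}) u′
  -- The remaining depth moves from `Fin 3` to `Fin 4` with its value unchanged.
  in f , T⇒∉ f∉ , inject₁ n , subst (λ m → T (safe m (k ▸ A) (f ▸ R))) (sym (Fin.toℕ-inject₁ n)) u″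

-- A pairing, when there is one, decides whether and how to answer; otherwise the game tree gives an
-- answer and loses one level.
safe-reply : ∀ {A R k} → Safe A R → k ∉ A → k ∉ R →
  Safe (k ▸ A) R ⊎ ∃ λ f → f ∉ k ▸ A × Safe (k ▸ A) (f ▸ R)
safe-reply {A} {R} {k} s k∉A k∉R = go s
  where
  fromPairing : T (safe 0 A R) → Safe (k ▸ A) R ⊎ ∃ λ f → f ∉ k ▸ A × Safe (k ▸ A) (f ▸ R)
  fromPairing t = Sum.map
    (λ g → zero , guarded-complete g)
    (λ (f , f∉ , g) → f , f∉ , zero , guarded-complete g)
    (guarded-reply k∉A (guarded-sound A R vertices₃ t))
  go : Safe A R → Safe (k ▸ A) R ⊎ ∃ λ f → f ∉ k ▸ A × Safe (k ▸ A) (f ▸ R)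
  go (zero  , t) = fromPairing t
  go (suc n , t) = Sum.[ fromPairing , (λ t′ → inj₂ (answered-reply n k∉A k∉R
      (All.lookup (all⁺ (answered (toℕ n) A R) (allFin 12) t′) (∈-allFin k)))) ]
    (Equivalence.to (T-∨ {safe 0 A R} {all (answered (toℕ n) A R) (allFin 12)})
      (proj₂ (Equivalence.to (T-∧ {alive A R} {safe 0 A R ∨ all (answered (toℕ n) A R) (allFin 12)}) t)))

-- Ends of the edges of `Q_3`.

opaque
  unfolding vertices₃

  star-ends : ∀ v → All (λ k → v ≡ low k ⊎ v ≡ high k) (star v)
  star-ends v = All.lookup checked (∈-vertices₃ v)
    where
    checked : All (λ v → All (λ k → v ≡ low k ⊎ v ≡ high k) (star v)) vertices₃
    checked = toWitness {a? = All.all? (λ v → All.all? (λ k →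
      ≡-dec Bool._≟_ v (low k) ⊎-dec ≡-dec Bool._≟_ v (high k)) (star v)) vertices₃} tt

  ends-injective : ∀ k l → (low k ≡ low l × high k ≡ high l) ⊎ (low k ≡ high l × high k ≡ low l) → k ≡ l
  ends-injective = toWitness {a? = Fin.all? λ k → Fin.all? λ l →
    ((low k ≟ᵥ low l ×-dec high k ≟ᵥ high l) ⊎-dec (low k ≟ᵥ high l ×-dec high k ≟ᵥ low l)) →-dec k ≟ l} tt
    where
    infix 4 _≟ᵥ_
    _≟ᵥ_ : (u v : Vertex₃) → Dec (u ≡ v)
    _≟ᵥ_ = ≡-dec Bool._≟_

-- Adjacency in hypercubes.

differ-here : ∀ {d a b} (u : Vec Bool d) → a ≢ b → DifferInOne (a ∷ u) (b ∷ u)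
differ-here u a≢b = zero , a≢b , λ { {zero} _ → refl ; {suc j} j≢ → contradiction refl j≢ }

differ-there : ∀ {d} a {u v : Vec Bool d} → DifferInOne u v → DifferInOne (a ∷ u) (a ∷ v)
differ-there a (i , i≢ , unique) =
  suc i , i≢ , λ { {zero} j≢ → contradiction refl j≢ ; {suc j} j≢ → cong suc (unique j≢) }

differ-++ : ∀ {m n} {u v : Vec Bool m} (w : Vec Bool n) → DifferInOne u v → DifferInOne (u ++ᵛ w) (v ++ᵛ w)
differ-++ {m} {n} {u} {v} w (i , i≢ , unique) =
  i ↑ˡ n ,
  (λ eq → i≢ (trans (sym (lookup-++ˡ u w i)) (trans eq (lookup-++ˡ v w i)))) ,
  λ {j} → uniq j
  where
  uniq : ∀ j → lookup (u ++ᵛ w) j ≢ lookup (v ++ᵛ w) j → i ↑ˡ n ≡ j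
  uniq j j≢ with splitAt m j in eq
  ... | inj₁ k with refl ← Fin.splitAt⁻¹-↑ˡ eq =
    cong (_↑ˡ n) (unique λ e → j≢ (trans (lookup-++ˡ u w k) (trans e (sym (lookup-++ˡ v w k)))))
  ... | inj₂ k with refl ← Fin.splitAt⁻¹-↑ʳ eq =
    contradiction (trans (lookup-++ʳ u w k) (sym (lookup-++ʳ v w k))) j≢

differ-insertAt : ∀ {d} (u : Vec Bool d) i → DifferInOne (insertAt u i false) (insertAt u i true)
differ-insertAt u       zero    = differ-here u λ ()
differ-insertAt (a ∷ u) (suc i) = differ-there a (differ-insertAt u i)

-- Triples of coordinates.

-- This recursion lets a triple index and a bit vector be split together by pattern matching.
thirds : ℕ → ℕ
thirds (suc (suc (suc d))) = suc (thirds d)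
thirds _                   = 0

thirds≡/3 : ∀ d → thirds d ≡ d / 3
thirds≡/3 0 = refl
thirds≡/3 1 = refl
thirds≡/3 2 = refl
thirds≡/3 (suc (suc (suc d))) =
  trans (cong suc (thirds≡/3 d)) (sym (m/n≡1+[m∸n]/n {suc (suc (suc d))} {3} (s≤s (s≤s (s≤s z≤n)))))

get : ∀ {d} → Fin (thirds d) → Vec Bool d → Vertex₃
get {suc (suc (suc d))} zero    (a ∷ b ∷ c ∷ x) = a ∷ b ∷ c ∷ []
get {suc (suc (suc d))} (suc g) (a ∷ b ∷ c ∷ x) = get g x

put : ∀ {d} → Fin (thirds d) → Vertex₃ → Vec Bool d → Vec Bool d
put {suc (suc (suc d))} zero    v (_ ∷ _ ∷ _ ∷ x) = v ++ᵛ x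
put {suc (suc (suc d))} (suc g) v (a ∷ b ∷ c ∷ x) = a ∷ b ∷ c ∷ put g v x

get-put : ∀ {d} (g : Fin (thirds d)) v x → get g (put g v x) ≡ v
get-put {suc (suc (suc d))} zero    (_ ∷ _ ∷ _ ∷ []) (a ∷ b ∷ c ∷ x) = refl
get-put {suc (suc (suc d))} (suc g) v                (a ∷ b ∷ c ∷ x) = get-put g v x

get-put′ : ∀ {d} {g h : Fin (thirds d)} v x → g ≢ h → get g (put h v x) ≡ get g x
get-put′ {suc (suc (suc d))} {zero}  {zero}  v x g≢h = contradiction refl g≢h
get-put′ {suc (suc (suc d))} {zero}  {suc h} v (a ∷ b ∷ c ∷ x) g≢h = refl
get-put′ {suc (suc (suc d))} {suc g} {zero}  (_ ∷ _ ∷ _ ∷ []) (a ∷ b ∷ c ∷ x) g≢h = refl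
get-put′ {suc (suc (suc d))} {suc g} {suc h} v (a ∷ b ∷ c ∷ x) g≢h = get-put′ v x (g≢h ∘ cong suc)

put-get : ∀ {d} (g : Fin (thirds d)) x → put g (get g x) x ≡ x
put-get {suc (suc (suc d))} zero    (a ∷ b ∷ c ∷ x) = refl
put-get {suc (suc (suc d))} (suc g) (a ∷ b ∷ c ∷ x) = cong (λ y → a ∷ b ∷ c ∷ y) (put-get g x)

put-put : ∀ {d} (g : Fin (thirds d)) u v x → put g u (put g v x) ≡ put g u x
put-put {suc (suc (suc d))} zero    u (_ ∷ _ ∷ _ ∷ []) (a ∷ b ∷ c ∷ x) = refl
put-put {suc (suc (suc d))} (suc g) u v (a ∷ b ∷ c ∷ x) = cong (λ y → a ∷ b ∷ c ∷ y) (put-put g u v x)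

put-differ : ∀ {d} (g : Fin (thirds d)) {u v} x → DifferInOne u v → DifferInOne (put g u x) (put g v x)
put-differ {suc (suc (suc d))} zero {u} {v} (a ∷ b ∷ c ∷ x) = differ-++ {u = u} {v} x
put-differ {suc (suc (suc d))} (suc g) (a ∷ b ∷ c ∷ x) =
  differ-there a ∘ differ-there b ∘ differ-there c ∘ put-differ g x

-- If `g` and `h` differed, both ends would carry the value `get g y` at triple `g`, against
-- `u ≢ u′`. If they agree, `x` and `y` coincide outside that triple.
put-same : ∀ {d} {g h : Fin (thirds d)} {u u′ v v′ x y} → u ≢ u′ →
  put g u x ≡ put h v y → put g u′ x ≡ put h v′ y → g ≡ h × u ≡ v × u′ ≡ v′ × (∀ w → put g w x ≡ put h w y)
put-same {d} {g} {h} {u} {u′} {v} {v′} {x} {y} u≢u′ eq eq′ with g ≟ h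
... | no g≢h = contradiction (trans (value u v eq) (sym (value u′ v′ eq′))) u≢u′
  where
  value : ∀ u v → put g u x ≡ put h v y → u ≡ get g y
  value u v eq = trans (sym (get-put g u x)) (trans (cong (get g) eq) (get-put′ v y g≢h))
... | yes refl = refl , value u v eq , value u′ v′ eq′ ,
  λ w → trans (sym (put-put g w u x)) (trans (cong (put g w) eq) (put-put g w v y))
  where
  value : ∀ u v → put g u x ≡ put g v y → u ≡ v
  value u v eq = trans (sym (get-put g u x)) (trans (cong (get g) eq) (get-put g v y))

low≢high : ∀ k → low k ≢ high k
low≢high k eq = Graph.~-irrefl (Q 3) {high k}
  (subst (λ v → DifferInOne v (high k)) eq (differ-insertAt (offset k) (axis k)))

-- Edge equality and decidability of claims.

module Claims (G : Graph) where
  open Graph G using (V; vertices; ∈-vertices) renaming (_≟_ to _≟ᵛ_; _~?_ to adjacent?)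
  open DegreeGame G

  ≈-sym : ∀ e f → e ≈ f → f ≈ e
  ≈-sym e f (inj₁ (p , q)) = inj₁ (sym p , sym q)
  ≈-sym e f (inj₂ (p , q)) = inj₂ (sym q , sym p)

  ≈-trans : ∀ e f g → e ≈ f → f ≈ g → e ≈ g
  ≈-trans e f g (inj₁ (p , q)) (inj₁ (r , s)) = inj₁ (trans p r , trans q s)
  ≈-trans e f g (inj₁ (p , q)) (inj₂ (r , s)) = inj₂ (trans p r , trans q s)
  ≈-trans e f g (inj₂ (p , q)) (inj₁ (r , s)) = inj₂ (trans p s , trans q r)
  ≈-trans e f g (inj₂ (p , q)) (inj₂ (r , s)) = inj₁ (trans p s , trans q r)

  _≈?_ : ∀ e f → Dec (e ≈ f)
  e ≈? f = ((src e ≟ᵛ src f) ×-dec (tgt e ≟ᵛ tgt f)) ⊎-dec ((src e ≟ᵛ tgt f) ×-dec (tgt e ≟ᵛ src f))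

  Claimed : List Edge → Edge → Set
  Claimed es e = Any (e ≈_) es

  claimed? : ∀ es e → Dec (Claimed es e)
  claimed? es e = any? (e ≈?_) es

  Claimed-≈ : ∀ {es} e f → e ≈ f → Claimed es e → Claimed es f
  Claimed-≈ e f e≈f = Any.map λ {g} → ≈-trans f e g (≈-sym e f e≈f)

  unclaimed? : ∀ p e → Dec (Unclaimed p e)
  unclaimed? p e = ¬? (claimed? (makerEdges p ++ breakerEdges p) e)

  anyVertex? : {P : V → Set} → (∀ x → Dec (P x)) → Dec (∃ P)
  anyVertex? P? = map′ Any.satisfied (λ (x , px) → lose (∈-vertices x) px) (any? P? vertices)

  allVertices? : {P : V → Set} → (∀ x → Dec (P x)) → Dec (∀ x → P x)
  allVertices? P? = map′ (λ ps x → All.lookup ps (∈-vertices x))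
    (λ ps → All.tabulate λ {x} _ → ps x) (All.all? P? vertices)

  anyUnclaimed? : ∀ p → Dec (∃ (Unclaimed p))
  anyUnclaimed? p = map′
    (λ (x , y , a , u) → edge x y a , u)
    (λ (e , u) → src e , tgt e , adj e , u)
    (anyVertex? λ x → anyVertex? λ y → adjacentAnd x y)
    where
    adjacentAnd : ∀ x y → Dec (∃ λ a → Unclaimed p (edge x y a))
    adjacentAnd x y with adjacent? x y
    ... | no ¬a = no (¬a ∘ proj₁)
    -- `Unclaimed` depends only on the ends, so one adjacency proof decides for all.
    ... | yes a = map′ (a ,_) proj₂ (unclaimed? p (edge x y a))

-- Boards in `Q_d` and the invariant.

module _ (d : ℕ) where
  open Graph (Q d) using (V)
  open DegreeGame (Q d)
  open Claims (Q d)

  -- The k-th edge of the copy of Q_3 through x whose directions form the g-th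
  -- triple; x and the seven other vertices of that copy name the same board.
  φ : Fin (thirds d) → V → Fin 12 → Edge
  φ g x k = edge (put g (low k) x) (put g (high k) x) (put-differ g x (differ-insertAt (offset k) (axis k)))

  -- Edge-disjointness of boards: a shared edge forces the same copy of `Q_3` with the same
  -- numbering, even under different names `x` and `y`.
  φ-same : ∀ {g h} x y k l → φ g x k ≈ φ h y l → g ≡ h × k ≡ l × (∀ m → φ g x m ≈ φ h y m)
  φ-same x y k l (inj₁ (p , q)) =
    let g≡h , r , s , same = put-same (low≢high k) p q
    in g≡h , ends-injective k l (inj₁ (r , s)) , λ m → inj₁ (same (low m) , same (high m))
  φ-same x y k l (inj₂ (p , q)) =
    let g≡h , r , s , same = put-same (low≢high k) p q
    in g≡h , ends-injective k l (inj₂ (r , s)) , λ m → inj₁ (same (low m) , same (high m))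

  -- Bounds instead of exact sets make extra edges of Breaker harmless.
  Bounded : List Edge → List Edge → Fin (thirds d) → V → EdgeSet₃ → EdgeSet₃ → Set
  Bounded ms bs g x A R =
    (∀ k → Claimed ms (φ g x k) → k ∈ A) × (∀ k → k ∈ R → Claimed bs (φ g x k))

  SafeBoard : Position → Fin (thirds d) → V → Set
  SafeBoard (position ms bs) g x = ∃₂ λ A R → Safe A R × Bounded ms bs g x A R

  Inv : Position → Set
  Inv p = ∀ g x → SafeBoard p g x

  safeBoard? : ∀ p g x → Dec (SafeBoard p g x)
  safeBoard? (position ms bs) g x = anySubset? λ A → anySubset? λ R →
    Fin.any? (λ n → T? (safe (toℕ n) A R)) ×-dec
    Fin.all? (λ k → claimed? ms (φ g x k) →-dec k ∈? A) ×-dec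
    Fin.all? (λ k → k ∈? R →-dec claimed? bs (φ g x k))

  opaque
    inv? : ∀ p → Dec (Inv p)
    inv? p = Fin.all? λ g → allVertices? λ x → safeBoard? p g x

  inv-start : Inv (position [] [])
  inv-start g x = ⊥ , ⊥ , safe-start , (λ k ()) , λ k k∈⊥ → contradiction k∈⊥ ∉⊥

  inv-breaker : ∀ {p} f → Inv p → Inv (claim Breaker f p)
  inv-breaker {position ms bs} f inv g x =
    let A , R , s , upper , lower = inv g x in A , R , s , upper , λ k k∈R → there (lower k k∈R)

  -- Only the board of `e` needs a new certificate. Its other names share that certificate, and `e`
  -- lies on no other board. Enlarging `bs` allows Breaker's answer to be included.
  inv-maker : ∀ {ms bs bs′} e g x k → e ≈ φ g x k → (∀ f → Claimed bs f → Claimed bs′ f) →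
    Inv (position ms bs) → SafeBoard (position (e ∷ ms) bs′) g x → Inv (position (e ∷ ms) bs′)
  inv-maker e g x k e≈ bs⊆bs′ inv (A , R , s , upper , lower) h y with Fin.any? (λ l → e ≈? φ h y l)
  ... | yes (l , e≈′) =
    let _ , _ , same = φ-same x y k l
          (≈-trans (φ g x k) e (φ h y l) (≈-sym e (φ g x k) e≈) e≈′)
    in A , R , s , (λ m → upper m ∘ Claimed-≈ (φ h y m) (φ g x m) (≈-sym (φ g x m) (φ h y m) (same m))) ,
       λ m → Claimed-≈ (φ g x m) (φ h y m) (same m) ∘ lower m
  ... | no ∄l =
    let A , R , s , upper , lower = inv h y
    in A , R , s , (λ { m (here ≈e) → contradiction (m , ≈-sym (φ h y m) e ≈e) ∄l
                     ; m (there c) → upper m c }) ,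
       λ m → bs⊆bs′ (φ h y m) ∘ lower m

  -- Breaker's answers and strategy.

  BoardReply : Position → Set
  BoardReply p = ∃₂ λ g x → ∃ λ k → Unclaimed p (φ g x k) × Inv (claim Breaker (φ g x k) p)

  opaque
    boardReply? : ∀ p → Dec (BoardReply p)
    boardReply? p = Fin.any? λ g → anyVertex? λ x → Fin.any? λ k →
      unclaimed? p (φ g x k) ×-dec inv? (claim Breaker (φ g x k) p)

    onBoard? : ∀ e → Dec (∃₂ λ g x → ∃ λ k → e ≈ φ g x k)
    onBoard? e = Fin.any? λ g → anyVertex? λ x → Fin.any? λ k → e ≈? φ g x k

  -- A move off all boards changes no bound; a move on a board is handled by `safe-reply` there.
  reply : ∀ {p} e → Inv p → Unclaimed p e → Inv (claim Maker e p) ⊎ BoardReply (claim Maker e p)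
  reply {position ms bs} e inv e∉ with onBoard? e
  ... | no ∄ = inj₁ λ g x → let A , R , s , upper , lower = inv g x in
    A , R , s , (λ { k (here ≈e) → contradiction (g , x , k , ≈-sym (φ g x k) e ≈e) ∄
                ; k (there c) → upper k c }) , lower
  ... | yes (g , x , k , e≈) = onBoard (inv g x)
    where
    same : ∀ l → φ g x l ≈ e → l ≡ k
    same l ≈e = proj₁ (proj₂ (φ-same x x l k (≈-trans (φ g x l) e (φ g x k) ≈e e≈)))

    upper▸ : ∀ {A} → (∀ l → Claimed ms (φ g x l) → l ∈ A) → ∀ l → Claimed (e ∷ ms) (φ g x l) → l ∈ k ▸ A
    upper▸ {A} upper l (here ≈e) with refl ← same l ≈e = ∈-▸ k A
    upper▸ {A} upper l (there c) = ⊆-▸ k A (upper l c)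

    lower▸ : ∀ {R f bs′} → (∀ h → Claimed bs h → Claimed bs′ h) → Claimed bs′ (φ g x f) →
      (∀ l → l ∈ R → Claimed bs (φ g x l)) → ∀ l → l ∈ f ▸ R → Claimed bs′ (φ g x l)
    lower▸ {R} {f} bs⊆bs′ c lower l l∈ with ▸-∈⁻ f R l∈
    ... | inj₁ refl = c
    ... | inj₂ l∈R  = bs⊆bs′ (φ g x l) (lower l l∈R)

    settled : SafeBoard (position (e ∷ ms) bs) g x → Inv (position (e ∷ ms) bs)
    settled = inv-maker e g x k e≈ (λ _ → id) inv

    onBoard : SafeBoard (position ms bs) g x →
      Inv (position (e ∷ ms) bs) ⊎ BoardReply (position (e ∷ ms) bs)
    onBoard (A , R , s , upper , lower) with k ∈? A
    -- As `A` is only an upper bound it may already allow for `k`, and then the old bounds stay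
    -- valid.
    ... | yes k∈A = inj₁ (settled (A , R , s , (λ
      { l (here ≈e) → subst (_∈ A) (sym (same l ≈e)) k∈A
      ; l (there c) → upper l c }) , lower))
    ... | no k∉A with safe-reply s k∉A (λ k∈R → e∉ (++⁺ʳ ms
           (Claimed-≈ (φ g x k) e (≈-sym e (φ g x k) e≈) (lower k k∈R))))
    ... | inj₁ s′ = inj₁ (settled (k ▸ A , R , s′ , upper▸ upper , lower))
    -- Breaker may already own `f` outside `R`; recording it in `R` then restores safety without a
    -- move. Maker cannot own it, since `f` lies outside the new upper bound.
    ... | inj₂ (f , f∉ , s′) with claimed? bs (φ g x f)
    ... | yes c = inj₁ (settled (k ▸ A , f ▸ R , s′ , upper▸ upper , lower▸ (λ _ → id) c lower))
    ... | no ¬c = inj₂ (g , x , f ,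
      (λ c → Sum.[ f∉ ∘ upper▸ upper f , ¬c ] (++⁻ (e ∷ ms) c)) ,
      inv-maker e g x k e≈ (λ _ → there) inv
        (k ▸ A , f ▸ R , s′ , upper▸ upper , lower▸ (λ _ → there) (here (inj₁ (refl , refl))) lower))

  -- A strategy sees only the position, so the certificates `A` and `R` are not remembered: an
  -- answer is found by exhaustive search.
  strategy : Strategy
  strategy p u with boardReply? p
  ... | yes (g , x , k , unclaimed , _) = φ g x k , unclaimed
  -- Decidability turns the irrelevant `u` into an actual edge.
  ... | no _                            = recompute (anyUnclaimed? p) u

  Maintained : Player → Position → Set
  Maintained Maker   p = Inv p
  Maintained Breaker p = Inv p ⊎ BoardReply p

  -- A successful search returns the invariant with its edge. If it fails, the invariant held before
  -- the move, and an arbitrary claim preserves it.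
  maintained : ∀ {P p} → Reachable strategy P p → Maintained P p
  maintained start              = inv-start
  maintained (makerMove r e e∉) = reply e (maintained r) e∉
  maintained (breakerMove {p} r u) with boardReply? p | maintained r
  ... | yes (_ , _ , _ , _ , inv) | _            = inv
  ... | no _                      | inj₁ inv     = inv-breaker _ inv
  ... | no ∄reply                 | inj₂ aReply  = contradiction aReply ∄reply

  -- Counting Breaker's edges at the end.

  safeBoard-star : ∀ {p} → Finished p → ∀ g x → SafeBoard p g x →
    Any (λ k → Claimed (breakerEdges p) (φ g x k)) (star (get g x))
  safeBoard-star {p@(position ms bs)} finished g x (A , R , s , upper , lower) =
    Any.map (λ {k} → Sum.[ lower k , notMaker k ]) (safe-star (get g x) s)
    where
    notMaker : ∀ k → k ∉ A → Claimed bs (φ g x k)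
    notMaker k k∉A = Sum.[ (λ c → contradiction (upper k c) k∉A) , id ]
      -- `Finished` yields only that the edge is not unclaimed; decidability makes it claimed.
      (++⁻ ms (decidable-stable (claimed? (ms ++ bs) (φ g x k)) λ ¬c → finished (φ g x k , ¬c)))

  φ-incident : ∀ g x k → get g x ≡ low k ⊎ get g x ≡ high k → Incident x (φ g x k)
  φ-incident g x k = Sum.map ends ends
    where
    ends : ∀ {v} → get g x ≡ v → x ≡ put g v x
    ends eq = trans (sym (put-get g x)) (cong (λ v → put g v x) eq)

  Incident-≈ : ∀ {x} e f → e ≈ f → Incident x e → Incident x f
  Incident-≈ e f (inj₁ (p , q)) = Sum.map (λ i → trans i p) (λ i → trans i q)
  Incident-≈ e f (inj₂ (p , q)) = Sum.swap ∘ Sum.map (λ i → trans i p) (λ i → trans i q)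

  incidentOnBoard : ∀ {p} → Finished p → Inv p → ∀ x g →
    ∃ λ k → Claimed (filter (incident? x) (breakerEdges p)) (φ g x k)
  incidentOnBoard {p} finished inv x g =
    let k , k∈ , c = find (safeBoard-star finished g x (inv g x))
        f , f∈ , φ≈f = find c
        x∈f = Incident-≈ (φ g x k) f φ≈f (φ-incident g x k (All.lookup (star-ends (get g x)) k∈))
    in k , lose (∈-filter⁺ (incident? x) f∈ x∈f) φ≈f

  -- Each triple gives a list index of a Breaker edge at `x`. Equal indices mean a common edge,
  -- hence equal triples by `φ-same`.
  degree-bound : ∀ {p} → Finished p → Inv p → ∀ x → thirds d ≤ breakerDegree p x
  degree-bound {p} finished inv x = Fin.injective⇒≤ {f = index} injective
    where
    es = filter (incident? x) (breakerEdges p)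
    local : Fin (thirds d) → Fin 12
    local g = proj₁ (incidentOnBoard finished inv x g)
    hit : ∀ g → Claimed es (φ g x (local g))
    hit g = proj₂ (incidentOnBoard finished inv x g)
    index : ∀ g → Fin (length es)
    index g = Any.index (hit g)
    edgeOf : Fin (thirds d) → Edge
    edgeOf g = φ g x (local g)
    injective : ∀ {g h} → index g ≡ index h → g ≡ h
    injective {g} {h} eq = proj₁ (φ-same x x (local g) (local h)
      (≈-trans (edgeOf g) (List.lookup es (index h)) (edgeOf h)
      (subst (λ i → edgeOf g ≈ List.lookup es i) eq (lookup-index (hit g)))
      (≈-sym (edgeOf h) (List.lookup es (index h)) (lookup-index (hit h)))))

  secures : BreakerCanSecure (Q d) (thirds d)
  secures = strategy , bound
    where
    bound : Secures strategy (thirds d)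
    bound {Maker}   r finished = degree-bound finished (maintained r)
    bound {Breaker} r finished y with maintained r
    ... | inj₁ inv                 = degree-bound finished inv y
    -- A pending answer is an unclaimed edge, so play is not over.
    ... | inj₂ (g , x , k , u , _) = contradiction (φ g x k , u) finished

theorem1 : (d : ℕ) → 1 ≤ d → BreakerCanSecure (Q d) (d / 3) × (∀ k → IsδB (Q d) k → d / 3 ≤ k)
theorem1 d _ = secured , λ k isδB → proj₂ isδB (d / 3) secured
  where
  secured : BreakerCanSecure (Q d) (d / 3)
  secured = subst (BreakerCanSecure (Q d)) (thirds≡/3 d) (secures d)
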